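{- The linear transformation $\mathbb{Q}[x]\to\mathbb{Q}[x]$ given by $x^n\mapsto\widetilde{Q}_n(x)$ for all $n\geq 0$ takes $B_n(x^2)$ into $x^{2n}$ for all $n\geq 1$, and takes $x\,b_n(x^2)$ into $x^{2n+1}$ for all $n\geq 0$, where $$B_n(x)=\sum_{k=1}^{n}\binom{n-1+k}{n-k}x^k\quad(n\geq 1),\qquad b_n(x)=\sum_{k=0}^{n}\binom{n+k}{n-k}x^k\quad(n\geq 0).$$
   Context: The polynomials $\widetilde{Q}_n(x)$ are given by $\widetilde{Q}_0(x)=1$ and $$ \widetilde{Q}_n(x)=\sum_{j=0}^{\left\lfloor \frac{n-1}{2}\right\rfloor}(-1)^j \left(\binom{n-1}{j}-\binom{n-1}{j-1}\right)x^{n-2j}\quad\text{for } n\geq 1, $$ with the convention $\binom{m}{ -1}=0$. The polynomials $B_n$ and $b_n$ are (up to the normalization used in the claim) the Morgan-Voyce polynomials. -}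

module Defs where

open import Algebra.Bundles.Raw using (RawRing)
open import Algebra.Module.Bundles.Raw using (RawLeftModule)
open import Algebra.Module.Morphism.Structures using (module LeftModuleMorphisms)
import Algebra.Definitions.RawSemiring as RawSemiringDefinitions
open import Data.Fin.Base using (toℕ)
open import Data.Integer.Base as ℤ using (ℤ; -1ℤ)
open import Data.List.Base using (List; []; _∷_; map)
open import Data.Nat.Base as ℕ using (ℕ; zero; suc; ⌊_/2⌋; _∸_)
open import Data.Nat.Combinatorics using (_C_)
open import Data.Product.Base using (∃-syntax; _×_; _,_)
open import Data.Rational.Base using (ℚ; 0ℚ; 1ℚ; _+_; _*_; -_; _/_)
open import Data.Rational.Properties
open import Function.Base using (_∘_)
open import Level using (0ℓ)
open import Relation.Binary.PropositionalEquality

-- The polynomial a₀ + a₁ x + … + aₙ xⁿ is the list a₀ ∷ a₁ ∷ … ∷ aₙ ∷ [].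
-- Trailing zeros are allowed, so equality of polynomials is _≈_ below and
-- not propositional equality of lists.

ℚ[x] : Set
ℚ[x] = List ℚ

coeff : ℚ[x] → ℕ → ℚ
coeff []      i       = 0ℚ
coeff (a ∷ p) zero    = a
coeff (a ∷ p) (suc i) = coeff p i

infix 4 _≈_

-- A record rather than a bare function type, so that p and q can be inferred.

record _≈_ (p q : ℚ[x]) : Set where
  constructor mk≈
  field
    coeff-≡ : ∀ i → coeff p i ≡ coeff q i

open _≈_ public

infixl 6 _+ₚ_
infixl 7 _*ₚ_
infixr 7 _·_
infix  8 -ₚ_

_+ₚ_ : ℚ[x] → ℚ[x] → ℚ[x]
[]      +ₚ q       = q
(a ∷ p) +ₚ []      = a ∷ p
(a ∷ p) +ₚ (b ∷ q) = a + b ∷ p +ₚ q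

-ₚ_ : ℚ[x] → ℚ[x]
-ₚ_ = map (-_)

_·_ : ℚ → ℚ[x] → ℚ[x]
c · p = map (c *_) p

_*ₚ_ : ℚ[x] → ℚ[x] → ℚ[x]
[]      *ₚ q = []
(a ∷ p) *ₚ q = a · q +ₚ (0ℚ ∷ p *ₚ q)

const : ℚ → ℚ[x]
const a = a ∷ []

x : ℚ[x]
x = 0ℚ ∷ 1ℚ ∷ []

ℚ[x]-rawRing : RawRing 0ℓ 0ℓ
ℚ[x]-rawRing = record
  { Carrier = ℚ[x]
  ; _≈_     = _≈_
  ; _+_     = _+ₚ_
  ; _*_     = _*ₚ_
  ; -_      = -ₚ_
  ; 0#      = []
  ; 1#      = const 1ℚ
  }

ℚ[x]-rawLeftModule : RawLeftModule ℚ 0ℓ 0ℓ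
ℚ[x]-rawLeftModule = record
  { Carrierᴹ = ℚ[x]
  ; _≈ᴹ_     = _≈_
  ; _+ᴹ_     = _+ₚ_
  ; _*ₗ_     = _·_
  ; 0ᴹ       = []
  ; -ᴹ_      = -ₚ_
  }

open RawSemiringDefinitions (RawRing.rawSemiring ℚ[x]-rawRing) public
  using (_^_; sum)

open LeftModuleMorphisms ℚ[x]-rawLeftModule ℚ[x]-rawLeftModule public
  using () renaming (IsLeftModuleHomomorphism to IsLinear)

infixl 9 _⟨_⟩

-- Composition: p ⟨ q ⟩ is p(q(x)).

_⟨_⟩ : ℚ[x] → ℚ[x] → ℚ[x]
[]      ⟨ q ⟩ = []
(a ∷ p) ⟨ q ⟩ = const a +ₚ q *ₚ p ⟨ q ⟩

∑< : ℕ → (ℕ → ℚ[x]) → ℚ[x]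
∑< n f = sum {n} (f ∘ toℕ)

infixl 5 ∑<

syntax ∑< n (λ i → p) = ∑[ i < n ] p

fromℤ : ℤ → ℚ
fromℤ z = z / 1

fromℕ : ℕ → ℚ
fromℕ m = fromℤ (ℤ.+ m)

-- m C-pred j is the binomial coefficient "m choose j - 1", which is 0 for j = 0.

_C-pred_ : ℕ → ℕ → ℕ
m C-pred zero  = 0
m C-pred suc j = m C j

Q̃ : ℕ → ℚ[x]
Q̃ zero        = const 1ℚ
Q̃ n@(suc n-1) = ∑[ j < suc ⌊ n-1 /2⌋ ]
  fromℤ (-1ℤ ℤ.^ j ℤ.* (ℤ.+ (n-1 C j) ℤ.- ℤ.+ (n-1 C-pred j))) · x ^ (n ∸ 2 ℕ.* j)

-- The summation index i stands for k - 1.  Only B n with n ≥ 1 is meaningful.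

B : ℕ → ℚ[x]
B n = ∑[ i < n ] (let k = suc i in
  fromℕ (((n ∸ 1) ℕ.+ k) C (n ∸ k)) · x ^ k)

b : ℕ → ℚ[x]
b n = ∑[ k < suc n ] fromℕ ((n ℕ.+ k) C (n ∸ k)) · x ^ k

-- A linear map with prescribed values on the powers of x exists, so
-- quantifying over all linear T with T (x ^ n) ≈ Q̃ n is not vacuous.

extend : (ℕ → ℚ[x]) → ℚ[x] → ℚ[x]
extend f []      = []
extend f (a ∷ p) = a · f 0 +ₚ extend (f ∘ suc) p

coeff-+ : ∀ p q i → coeff (p +ₚ q) i ≡ coeff p i + coeff q i
coeff-+ []      q       i       = sym (+-identityˡ _)
coeff-+ (a ∷ p) []      i       = sym (+-identityʳ _)
coeff-+ (a ∷ p) (b ∷ q) zero    = refl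
coeff-+ (a ∷ p) (b ∷ q) (suc i) = coeff-+ p q i

coeff-· : ∀ c p i → coeff (c · p) i ≡ c * coeff p i
coeff-· c []      i       = sym (*-zeroʳ c)
coeff-· c (a ∷ p) zero    = refl
coeff-· c (a ∷ p) (suc i) = coeff-· c p i

coeff-neg : ∀ p i → coeff (-ₚ p) i ≡ - coeff p i
coeff-neg []      i       = refl
coeff-neg (a ∷ p) zero    = refl
coeff-neg (a ∷ p) (suc i) = coeff-neg p i

coeff-extend-∷ : ∀ f a p i →
  coeff (extend f (a ∷ p)) i ≡ a * coeff (f 0) i + coeff (extend (f ∘ suc) p) i
coeff-extend-∷ f a p i =
  trans (coeff-+ (a · f 0) _ i) (cong (_+ _) (coeff-· a (f 0) i))

extend-zero : ∀ f p → p ≈ [] → ∀ i → coeff (extend f p) i ≡ 0ℚ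
extend-zero f []      p≈0 i = refl
extend-zero f (a ∷ p) p≈0 i
  rewrite coeff-extend-∷ f a p i | coeff-≡ p≈0 0
        | extend-zero (f ∘ suc) p (mk≈ (coeff-≡ p≈0 ∘ suc)) i
        = trans (+-identityʳ _) (*-zeroˡ (coeff (f 0) i))

extend-cong : ∀ f p q → p ≈ q → ∀ i → coeff (extend f p) i ≡ coeff (extend f q) i
extend-cong f []      q       p≈q i =
  sym (extend-zero f q (mk≈ (sym ∘ coeff-≡ p≈q)) i)
extend-cong f (a ∷ p) []      p≈q i = extend-zero f (a ∷ p) p≈q i
extend-cong f (a ∷ p) (b ∷ q) p≈q i
  rewrite coeff-extend-∷ f a p i | coeff-extend-∷ f b q i | coeff-≡ p≈q 0
        | extend-cong (f ∘ suc) p q (mk≈ (coeff-≡ p≈q ∘ suc)) i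
        = refl

+-interchange : ∀ s t u v → (s + t) + (u + v) ≡ (s + u) + (t + v)
+-interchange s t u v = begin
  (s + t) + (u + v) ≡⟨ +-assoc s t (u + v) ⟩
  s + (t + (u + v)) ≡⟨ cong (s +_) (+-assoc t u v) ⟨
  s + ((t + u) + v) ≡⟨ cong (λ w → s + (w + v)) (+-comm t u) ⟩
  s + ((u + t) + v) ≡⟨ cong (s +_) (+-assoc u t v) ⟩
  s + (u + (t + v)) ≡⟨ +-assoc s u (t + v) ⟨
  (s + u) + (t + v) ∎
  where open ≡-Reasoning

extend-+ : ∀ f p q i → coeff (extend f (p +ₚ q)) i ≡ coeff (extend f p +ₚ extend f q) i
extend-+ f []      q       i = refl
extend-+ f (a ∷ p) []      i =
  sym (trans (coeff-+ (extend f (a ∷ p)) [] i) (+-identityʳ _))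
extend-+ f (a ∷ p) (b ∷ q) i
  rewrite coeff-+ (extend f (a ∷ p)) (extend f (b ∷ q)) i
        | coeff-extend-∷ f a p i | coeff-extend-∷ f b q i
        | coeff-extend-∷ f (a + b) (p +ₚ q) i
        | extend-+ (f ∘ suc) p q i
        | coeff-+ (extend (f ∘ suc) p) (extend (f ∘ suc) q) i
        | *-distribʳ-+ (coeff (f 0) i) a b
        = +-interchange (a * coeff (f 0) i) _ _ _

extend-· : ∀ f c p i → coeff (extend f (c · p)) i ≡ coeff (c · extend f p) i
extend-· f c []      i = refl
extend-· f c (a ∷ p) i
  rewrite coeff-· c (extend f (a ∷ p)) i
        | coeff-extend-∷ f a p i | coeff-extend-∷ f (c * a) (c · p) i
        | extend-· (f ∘ suc) c p i
        | coeff-· c (extend (f ∘ suc) p) i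
        | *-distribˡ-+ c (a * coeff (f 0) i) (coeff (extend (f ∘ suc) p) i)
        | *-assoc c a (coeff (f 0) i)
        = refl

extend-neg : ∀ f p i → coeff (extend f (-ₚ p)) i ≡ coeff (-ₚ extend f p) i
extend-neg f []      i = refl
extend-neg f (a ∷ p) i
  rewrite coeff-neg (extend f (a ∷ p)) i
        | coeff-extend-∷ f a p i | coeff-extend-∷ f (- a) (-ₚ p) i
        | extend-neg (f ∘ suc) p i
        | coeff-neg (extend (f ∘ suc) p) i
        | neg-distrib-+ (a * coeff (f 0) i) (coeff (extend (f ∘ suc) p) i)
        | neg-distribˡ-* a (coeff (f 0) i)
        = refl

x*ₚ≈shift : ∀ p → x *ₚ p ≈ 0ℚ ∷ p
x*ₚ≈shift p = mk≈ λ i → trans (coeff-+ (0ℚ · p) _ i)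
  (trans (cong₂ _+_ (trans (coeff-· 0ℚ p i) (*-zeroˡ (coeff p i))) (shift i))
         (+-identityˡ _))
  where
  shift : ∀ i → coeff (0ℚ ∷ const 1ℚ *ₚ p) i ≡ coeff (0ℚ ∷ p) i
  shift zero    = refl
  shift (suc i) = trans (coeff-+ (1ℚ · p) (const 0ℚ) i)
    (trans (cong₂ _+_ (trans (coeff-· 1ℚ p i) (*-identityˡ (coeff p i))) (coeff-0 i))
           (+-identityʳ (coeff p i)))
    where
    coeff-0 : ∀ i → coeff (const 0ℚ) i ≡ 0ℚ
    coeff-0 zero    = refl
    coeff-0 (suc i) = refl

extend-^ : ∀ f n i → coeff (extend f (x ^ n)) i ≡ coeff (f n) i
extend-^ f zero    i = trans (coeff-extend-∷ f 1ℚ [] i)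
  (trans (+-identityʳ _) (*-identityˡ (coeff (f 0) i)))
extend-^ f (suc n) i = begin
  coeff (extend f (x *ₚ x ^ n)) i
    ≡⟨ extend-cong f _ _ (x*ₚ≈shift (x ^ n)) i ⟩
  coeff (extend f (0ℚ ∷ x ^ n)) i
    ≡⟨ coeff-extend-∷ f 0ℚ (x ^ n) i ⟩
  0ℚ * coeff (f 0) i + coeff (extend (f ∘ suc) (x ^ n)) i
    ≡⟨ cong (_+ coeff (extend (f ∘ suc) (x ^ n)) i) (*-zeroˡ (coeff (f 0) i)) ⟩
  0ℚ + coeff (extend (f ∘ suc) (x ^ n)) i
    ≡⟨ +-identityˡ _ ⟩
  coeff (extend (f ∘ suc) (x ^ n)) i
    ≡⟨ extend-^ (f ∘ suc) n i ⟩
  coeff (f (suc n)) i ∎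
  where open ≡-Reasoning

extend-isLinear : ∀ f → IsLinear (extend f)
extend-isLinear f = record
  { +ᴹ-isGroupHomomorphism = record
    { isMonoidHomomorphism = record
      { isMagmaHomomorphism = record
        { isRelHomomorphism = record
          { cong = λ {p} {q} p≈q → mk≈ (extend-cong f p q p≈q) }
        ; homo = λ p q → mk≈ (extend-+ f p q)
        }
      ; ε-homo = mk≈ λ i → refl
      }
    ; ⁻¹-homo = λ p → mk≈ (extend-neg f p)
    }
  ; *ₗ-homo = λ c p → mk≈ (extend-· f c p)
  }

linear-map-exists : (f : ℕ → ℚ[x]) → ∃[ T ] IsLinear T × (∀ n → T (x ^ n) ≈ f n)
linear-map-exists f = extend f , extend-isLinear f , λ n → mk≈ (extend-^ f n)

{-# OPTIONS --safe #-}

-- On polynomials without constant term put M xᵏ = xᵏ⁺¹ - xᵏ⁻¹, dropping xᵏ⁻¹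
-- when k = 1.  Pascal's rule gives Q̃ (n + 2) = M (Q̃ (n + 1)), so T (x p) = M (T p)
-- whenever p has no constant term.  The polynomials u₂ₙ = Bₙ(x²) and
-- u₂ₙ₊₁ = x bₙ(x²) satisfy the Fibonacci recurrence uₖ₊₂ = x uₖ₊₁ + uₖ, again by
-- Pascal's rule, so inductively T uₖ₊₂ = M xᵏ⁺¹ + T uₖ = xᵏ⁺².

module Submission where

open import Defs
open import Data.Nat.Base using (ℕ; _+_; _*_; _≥_)
open import Data.Product.Base using (_×_)

open import Algebra.Module.Morphism.Structures using (module LeftModuleMorphisms)
open import Data.Integer.Base as ℤ using (ℤ; -1ℤ)
import Data.Integer.Properties as ℤ
import Data.Integer.Solver as ℤ
open import Data.List.Base using ([]; _∷_; _++_; replicate)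
open import Data.Nat.Base using (zero; suc; _∸_; _≤_; _<_; ⌊_/2⌋; z≤n; s≤s)
open import Data.Nat.Combinatorics using (_C_; nCk≡nC[n∸k]; nCk+nC[k+1]≡[n+1]C[k+1]; k>n⇒nCk≡0)
open import Data.Nat.Properties
open import Data.Product.Base using (_,_; proj₁; proj₂)
open import Data.Rational.Base as ℚ using (ℚ; 0ℚ; 1ℚ)
import Data.Rational.Properties as ℚ
import Data.Rational.Solver as ℚ
import Data.Rational.Unnormalised.Base as ℚᵘ
import Data.Rational.Unnormalised.Properties as ℚᵘ
open import Function.Base using (_∘_)
open import Relation.Binary.PropositionalEquality
open ≡-Reasoning

open LeftModuleMorphisms.IsLeftModuleHomomorphism using (⟦⟧-cong; +ᴹ-homo; *ₗ-homo; 0ᴹ-homo)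
open ℚ.+-*-Solver using () renaming (solve to solveℚ; _:=_ to _⊜_; _:+_ to _⊕_; _:*_ to _⊗_; _:-_ to _⊖_)

-- The embedding of ℤ into ℚ

fromℤ≃ : ∀ i → ℚ.toℚᵘ (fromℤ i) ℚᵘ.≃ ℚᵘ.mkℚᵘ i 0
fromℤ≃ i = ℚ.toℚᵘ-fromℚᵘ (ℚᵘ.mkℚᵘ i 0)

-- Normalisation by a gcd keeps `fromℤ` from computing on variables. Over unnormalised rationals all
-- denominators here are 1, and `toℚᵘ` is injective.
fromℤ-+ : ∀ i j → fromℤ (i ℤ.+ j) ≡ fromℤ i ℚ.+ fromℤ j
fromℤ-+ i j = ℚ.toℚᵘ-injective
  (ℚᵘ.≃-trans (fromℤ≃ (i ℤ.+ j))
  (ℚᵘ.≃-trans (ℚᵘ.*≡* (cong (ℤ._* ℤ.1ℤ) (cong₂ ℤ._+_ (sym (ℤ.*-identityʳ i)) (sym (ℤ.*-identityʳ j)))))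
  (ℚᵘ.≃-trans (ℚᵘ.≃-sym (ℚᵘ.+-cong (fromℤ≃ i) (fromℤ≃ j)))
              (ℚᵘ.≃-sym (ℚ.toℚᵘ-homo-+ (fromℤ i) (fromℤ j))))))

-- Additivity suffices: `i` is `(i - j) + j`, and `fromℤ j` cancels.
fromℤ-- : ∀ i j → fromℤ (i ℤ.- j) ≡ fromℤ i ℚ.- fromℤ j
fromℤ-- i j = begin
  fromℤ (i ℤ.- j)                                ≡⟨ solveℚ 2 (λ a b → a ⊜ (a ⊕ b) ⊖ b) refl (fromℤ (i ℤ.- j)) (fromℤ j) ⟩
  (fromℤ (i ℤ.- j) ℚ.+ fromℤ j) ℚ.- fromℤ j      ≡⟨ cong (ℚ._- fromℤ j) (fromℤ-+ (i ℤ.- j) j) ⟨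
  fromℤ (i ℤ.- j ℤ.+ j) ℚ.- fromℤ j              ≡⟨ cong (λ k → fromℤ k ℚ.- fromℤ j) (solve 2 (λ a b → a :- b :+ b := a) refl i j) ⟩
  fromℤ i ℚ.- fromℤ j                            ∎
  where open ℤ.+-*-Solver

fromℕ-+ : ∀ m n → fromℕ (m + n) ≡ fromℕ m ℚ.+ fromℕ n
fromℕ-+ m n = fromℤ-+ (ℤ.+ m) (ℤ.+ n)

-- Coefficients of powers and sums

coeff-x^-zero : ∀ n → coeff (x ^ suc n) 0 ≡ 0ℚ
coeff-x^-zero n = coeff-≡ (x*ₚ≈shift (x ^ n)) 0

coeff-x^-suc : ∀ n i → coeff (x ^ suc n) (suc i) ≡ coeff (x ^ n) i
coeff-x^-suc n i = coeff-≡ (x*ₚ≈shift (x ^ n)) (suc i)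

-- `sum` unfolds at its first term, whereas the recurrence for `Q̃` is proved by induction on the
-- last one.
coeff-∑-last : ∀ n f i → coeff (∑< (suc n) f) i ≡ coeff (∑< n f) i ℚ.+ coeff (f n) i
coeff-∑-last zero f i = trans (coeff-+ (f 0) [] i) (ℚ.+-comm (coeff (f 0) i) 0ℚ)
coeff-∑-last (suc n) f i = begin
  coeff (f 0 +ₚ ∑< (suc n) (f ∘ suc)) i
    ≡⟨ coeff-+ (f 0) _ i ⟩
  coeff (f 0) i ℚ.+ coeff (∑< (suc n) (f ∘ suc)) i
    ≡⟨ cong (coeff (f 0) i ℚ.+_) (coeff-∑-last n (f ∘ suc) i) ⟩
  coeff (f 0) i ℚ.+ (coeff (∑< n (f ∘ suc)) i ℚ.+ coeff (f (suc n)) i)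
    ≡⟨ ℚ.+-assoc (coeff (f 0) i) _ _ ⟨
  coeff (f 0) i ℚ.+ coeff (∑< n (f ∘ suc)) i ℚ.+ coeff (f (suc n)) i
    ≡⟨ cong (ℚ._+ coeff (f (suc n)) i) (coeff-+ (f 0) _ i) ⟨
  coeff (f 0 +ₚ ∑< n (f ∘ suc)) i ℚ.+ coeff (f (suc n)) i ∎

-- The exponents form an arbitrary function `e` because the tail of the sum has exponents `e ∘ suc`.
coeff-∑-x^suc-zero : ∀ n (c : ℕ → ℚ) (e : ℕ → ℕ) → coeff (∑[ k < n ] c k · x ^ suc (e k)) 0 ≡ 0ℚ
coeff-∑-x^suc-zero zero    c e = refl
coeff-∑-x^suc-zero (suc n) c e
  rewrite coeff-+ (c 0 · x ^ suc (e 0)) (∑[ k < n ] c (suc k) · x ^ suc (e (suc k))) 0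
        | coeff-· (c 0) (x ^ suc (e 0)) 0
        | coeff-x^-zero (e 0)
        | coeff-∑-x^suc-zero n (c ∘ suc) (e ∘ suc)
        | ℚ.*-zeroʳ (c 0)
        = refl

coeff-∑-x^suc-suc : ∀ n (c : ℕ → ℚ) (e : ℕ → ℕ) i →
  coeff (∑[ k < n ] c k · x ^ suc (e k)) (suc i) ≡ coeff (∑[ k < n ] c k · x ^ e k) i
coeff-∑-x^suc-suc zero    c e i = refl
coeff-∑-x^suc-suc (suc n) c e i
  rewrite coeff-+ (c 0 · x ^ suc (e 0)) (∑[ k < n ] c (suc k) · x ^ suc (e (suc k))) (suc i)
        | coeff-+ (c 0 · x ^ e 0) (∑[ k < n ] c (suc k) · x ^ e (suc k)) i
        | coeff-· (c 0) (x ^ suc (e 0)) (suc i)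
        | coeff-· (c 0) (x ^ e 0) i
        | coeff-x^-suc (e 0) i
        | coeff-∑-x^suc-suc n (c ∘ suc) (e ∘ suc) i
        = refl

-- Serves to replace `c`, given by a formula with truncated subtraction, by a closed form `d` that
-- is correct at every index and vanishes by itself beyond the range of summation.
coeff-∑-x^ : ∀ n (c d : ℕ → ℚ) → (∀ {k} → k < n → c k ≡ d k) → (∀ {k} → n ≤ k → d k ≡ 0ℚ) →
  ∀ i → coeff (∑[ k < n ] c k · x ^ k) i ≡ d i
coeff-∑-x^ zero    c d c≡d d≡0 i = sym (d≡0 z≤n)
coeff-∑-x^ (suc n) c d c≡d d≡0 zero
  rewrite coeff-+ (c 0 · x ^ 0) (∑[ k < n ] c (suc k) · x ^ suc k) 0
        | coeff-∑-x^suc-zero n (c ∘ suc) (λ k → k)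
        = trans (ℚ.+-identityʳ _) (trans (ℚ.*-identityʳ (c 0)) (c≡d (s≤s z≤n)))
coeff-∑-x^ (suc n) c d c≡d d≡0 (suc i)
  rewrite coeff-+ (c 0 · x ^ 0) (∑[ k < n ] c (suc k) · x ^ suc k) (suc i)
        | coeff-∑-x^suc-suc n (c ∘ suc) (λ k → k) i
        = trans (ℚ.+-identityˡ _)
                (coeff-∑-x^ n (c ∘ suc) (d ∘ suc) (c≡d ∘ s≤s) (d≡0 ∘ s≤s) i)

-- The recurrence for Q̃

C-pascal : ∀ n j → suc n C j ≡ n C j + n C-pred j
C-pascal n zero    = refl
C-pascal n (suc j) = trans (sym (nCk+nC[k+1]≡[n+1]C[k+1] n j)) (+-comm (n C j) (n C suc j))

-- For 2j ≤ n the difference of binomials is a ballot number: it counts the n-step paths with j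
-- down-steps that never go below their start.
signedBallot : ℕ → ℕ → ℤ
signedBallot n j = -1ℤ ℤ.^ j ℤ.* (ℤ.+ (n C j) ℤ.- ℤ.+ (n C-pred j))

-- Pascal's rule turns the difference into (p + q) - (q + r) = (p - q) + (q - r), and the additional
-- sign makes the second bracket negative.
signedBallot-pascal : ∀ n j →
  signedBallot (suc n) (suc j) ≡ signedBallot n (suc j) ℤ.- signedBallot n j
signedBallot-pascal n j
  rewrite C-pascal n (suc j) | C-pascal n j
        | ℤ.pos-+ (n C suc j) (n C j) | ℤ.pos-+ (n C j) (n C-pred j)
        = solve 4 (λ e p q r → con -1ℤ :* e :* ((p :+ q) :- (q :+ r))
                            := con -1ℤ :* e :* (p :- q) :- e :* (q :- r))
                refl (-1ℤ ℤ.^ j) (ℤ.+ (n C suc j)) (ℤ.+ (n C j)) (ℤ.+ (n C-pred j))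
  where open ℤ.+-*-Solver

-- Row 2k + 1 has two equal middle binomials, in columns k and k + 1.
signedBallot-middle : ∀ k → signedBallot (suc (k + k)) (suc k) ≡ ℤ.0ℤ
signedBallot-middle k = begin
  e ℤ.* (ℤ.+ (n C suc k) ℤ.- ℤ.+ (n C k)) ≡⟨ cong (λ c → e ℤ.* (ℤ.+ c ℤ.- ℤ.+ (n C k))) nC[1+k]≡nCk ⟩
  e ℤ.* (ℤ.+ (n C k) ℤ.- ℤ.+ (n C k))     ≡⟨ cong (e ℤ.*_) (ℤ.+-inverseʳ (ℤ.+ (n C k))) ⟩
  e ℤ.* ℤ.0ℤ                              ≡⟨ ℤ.*-zeroʳ e ⟩
  ℤ.0ℤ                                    ∎
  where
  n = suc (k + k)
  e = -1ℤ ℤ.^ suc k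
  nC[1+k]≡nCk : n C suc k ≡ n C k
  nC[1+k]≡nCk = trans (nCk≡nC[n∸k] (s≤s (m≤m+n k k))) (cong (n C_) (m+n∸m≡n k k))

-- `Q̃ (suc n)` is `ballotSum (suc ⌊ n /2⌋) n` by definition. A free number of terms `m` permits
-- induction on `m` with `n` fixed.
ballotSum : ℕ → ℕ → ℚ[x]
ballotSum m n = ∑[ j < m ] fromℤ (signedBallot n j) · x ^ (suc n ∸ 2 * j)

coeff-ballotSum-last : ∀ m n i → coeff (ballotSum (suc m) n) i ≡
  coeff (ballotSum m n) i ℚ.+ fromℤ (signedBallot n m) ℚ.* coeff (x ^ (suc n ∸ 2 * m)) i
coeff-ballotSum-last m n i =
  trans (coeff-∑-last m (λ j → fromℤ (signedBallot n j) · x ^ (suc n ∸ 2 * j)) i)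
        (cong (coeff (ballotSum m n) i ℚ.+_) (coeff-· (fromℤ (signedBallot n m)) (x ^ (suc n ∸ 2 * m)) i))

2*suc : ∀ m → 2 * suc m ≡ 2 + 2 * m
2*suc m = *-suc 2 m

coeff-x^-∸-suc : ∀ {k n} i → k ≤ n → coeff (x ^ (suc n ∸ k)) (suc i) ≡ coeff (x ^ (n ∸ k)) i
coeff-x^-∸-suc {k} {n} i k≤n rewrite +-∸-assoc 1 k≤n = coeff-x^-suc (n ∸ k) i

-- The bound says that the last index j = m - 1 satisfies 2j ≤ n, so every exponent is positive.
ballotSum-zero : ∀ m n → 2 * m ≤ 2 + n → coeff (ballotSum m n) 0 ≡ 0ℚ
ballotSum-zero zero    n _   = refl
ballotSum-zero (suc m) n 2m≤ with subst (_≤ 2 + n) (2*suc m) 2m≤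
... | s≤s (s≤s 2m≤n)
  rewrite coeff-ballotSum-last m n 0
        | ballotSum-zero m n (m≤n⇒m≤1+n (m≤n⇒m≤1+n 2m≤n))
        | +-∸-assoc 1 2m≤n
        | coeff-x^-zero (n ∸ 2 * m)
        = trans (ℚ.+-identityˡ _) (ℚ.*-zeroʳ (fromℤ (signedBallot n m)))

-- By `signedBallot-pascal`, term j + 1 on the left splits into term j + 1 of the first sum and term
-- j of the second, which therefore has one term fewer. The bound keeps every subtraction in the
-- exponents exact.
ballotSum-step : ∀ m n i → 2 * m ≤ suc n → coeff (ballotSum (suc m) (suc n)) (suc i) ≡
  coeff (ballotSum (suc m) n) i ℚ.- coeff (ballotSum m n) (2 + i)
ballotSum-step zero n i _
  rewrite coeff-ballotSum-last 0 (suc n) (suc i)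
        | coeff-ballotSum-last 0 n i
        | coeff-x^-suc (suc n) i
        = sym (ℚ.+-identityʳ _)
ballotSum-step (suc m) n i 2m≤ = begin
  coeff (ballotSum (suc (suc m)) (suc n)) (suc i)
    ≡⟨ coeff-ballotSum-last (suc m) (suc n) (suc i) ⟩
  coeff (ballotSum (suc m) (suc n)) (suc i) ℚ.+
    fromℤ (signedBallot (suc n) (suc m)) ℚ.* coeff (x ^ (2 + n ∸ 2 * suc m)) (suc i)
    ≡⟨ cong₂ (λ a c → a ℚ.+ c ℚ.* coeff (x ^ (2 + n ∸ 2 * suc m)) (suc i))
         (ballotSum-step m n i (≤-trans (*-monoʳ-≤ 2 (n≤1+n m)) 2m≤))
         (trans (cong fromℤ (signedBallot-pascal n m)) (fromℤ-- (signedBallot n (suc m)) (signedBallot n m))) ⟩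
  (p ℚ.- q) ℚ.+ (s ℚ.- t) ℚ.* coeff (x ^ (2 + n ∸ 2 * suc m)) (suc i)
    ≡⟨ cong (λ z → (p ℚ.- q) ℚ.+ (s ℚ.- t) ℚ.* z) (coeff-x^-∸-suc i 2m≤) ⟩
  (p ℚ.- q) ℚ.+ (s ℚ.- t) ℚ.* y
    ≡⟨ solveℚ 5 (λ p q s t y → (p ⊖ q) ⊕ (s ⊖ t) ⊗ y ⊜ (p ⊕ s ⊗ y) ⊖ (q ⊕ t ⊗ y)) refl p q s t y ⟩
  (p ℚ.+ s ℚ.* y) ℚ.- (q ℚ.+ t ℚ.* y)
    ≡⟨ cong (λ z → (p ℚ.+ s ℚ.* y) ℚ.- (q ℚ.+ t ℚ.* z)) y≡ ⟩
  (p ℚ.+ s ℚ.* y) ℚ.- (q ℚ.+ t ℚ.* coeff (x ^ (suc n ∸ 2 * m)) (2 + i))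
    ≡⟨ cong₂ ℚ._-_ (coeff-ballotSum-last (suc m) n i) (coeff-ballotSum-last m n (2 + i)) ⟨
  coeff (ballotSum (suc (suc m)) n) i ℚ.- coeff (ballotSum (suc m) n) (2 + i) ∎
  where
  p = coeff (ballotSum (suc m) n) i
  q = coeff (ballotSum m n) (2 + i)
  s = fromℤ (signedBallot n (suc m))
  t = fromℤ (signedBallot n m)
  y = coeff (x ^ (suc n ∸ 2 * suc m)) i
  y≡ : y ≡ coeff (x ^ (suc n ∸ 2 * m)) (2 + i)
  y≡ = begin
    coeff (x ^ (suc n ∸ 2 * suc m)) i
      ≡⟨ cong (λ k → coeff (x ^ (suc n ∸ k)) i) (2*suc m) ⟩
    coeff (x ^ (suc n ∸ (2 + 2 * m))) i
      ≡⟨ coeff-x^-∸-suc {2 + 2 * m} {suc n} i 2+2m≤ ⟨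
    coeff (x ^ (suc n ∸ suc (2 * m))) (suc i)
      ≡⟨ coeff-x^-∸-suc {suc (2 * m)} {suc n} (suc i) (≤-trans (n≤1+n _) 2+2m≤) ⟨
    coeff (x ^ (suc n ∸ 2 * m)) (2 + i) ∎
    where
    2+2m≤ : 2 + 2 * m ≤ suc n
    2+2m≤ = subst (_≤ suc n) (2*suc m) 2m≤

-- `Q̃ (2 + n)` has as many terms as `Q̃ (1 + n)` for even n and one more for odd n.
data Parity : ℕ → Set where
  even : ∀ k → Parity (k + k)
  odd  : ∀ k → Parity (suc (k + k))

parity : ∀ n → Parity n
parity zero = even 0
parity (suc n) with parity n
... | even k = odd k
... | odd  k = subst Parity (cong suc (+-suc k k)) (even (suc k))

⌊1+n+n/2⌋ : ∀ n → ⌊ suc (n + n) /2⌋ ≡ n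
⌊1+n+n/2⌋ zero    = refl
⌊1+n+n/2⌋ (suc n) rewrite +-suc n n = cong suc (⌊1+n+n/2⌋ n)

Q̃-zero : ∀ n → coeff (Q̃ (suc n)) 0 ≡ 0ℚ
Q̃-zero n = ballotSum-zero (suc ⌊ n /2⌋) n (subst (_≤ 2 + n) (sym (2*suc ⌊ n /2⌋)) (s≤s (s≤s 2⌊n/2⌋≤n)))
  where
  2⌊n/2⌋≤n : 2 * ⌊ n /2⌋ ≤ n
  2⌊n/2⌋≤n rewrite +-identityʳ ⌊ n /2⌋ =
    ≤-trans (+-monoʳ-≤ ⌊ n /2⌋ (⌊n/2⌋≤⌈n/2⌉ n)) (≤-reflexive (⌊n/2⌋+⌈n/2⌉≡n n))

-- The two sides sum over different ranges of j.  For even n the surplus term is a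
-- constant times x, which is invisible at 2 + i; for odd n it is a multiple of the
-- difference of the two equal middle binomials.
Q̃-suc : ∀ n i →
  coeff (Q̃ (2 + n)) (suc i) ≡ coeff (Q̃ (1 + n)) i ℚ.- coeff (Q̃ (1 + n)) (2 + i)
Q̃-suc n i with parity n
... | even k rewrite ⌊1+n+n/2⌋ k | sym (n≡⌊n+n/2⌋ k) = begin
  coeff (ballotSum (suc k) (suc (k + k))) (suc i)
    ≡⟨ ballotSum-step k (k + k) i (subst (_≤ suc (k + k)) 2k≡ (n≤1+n (k + k))) ⟩
  coeff (ballotSum (suc k) (k + k)) i ℚ.- coeff (ballotSum k (k + k)) (2 + i)
    ≡⟨ cong (λ q → coeff (ballotSum (suc k) (k + k)) i ℚ.- q) drop-last ⟨
  coeff (ballotSum (suc k) (k + k)) i ℚ.- coeff (ballotSum (suc k) (k + k)) (2 + i) ∎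
  where
  2k≡ : k + k ≡ 2 * k
  2k≡ = cong (k +_) (sym (+-identityʳ k))
  drop-last : coeff (ballotSum (suc k) (k + k)) (2 + i) ≡ coeff (ballotSum k (k + k)) (2 + i)
  drop-last rewrite coeff-ballotSum-last k (k + k) (2 + i)
               | sym 2k≡ | m+n∸n≡m 1 (k + k)
    = trans (cong (coeff (ballotSum k (k + k)) (2 + i) ℚ.+_) (ℚ.*-zeroʳ (fromℤ (signedBallot (k + k) k))))
            (ℚ.+-identityʳ _)
... | odd k rewrite ⌊1+n+n/2⌋ k | sym (n≡⌊n+n/2⌋ k) = begin
  coeff (ballotSum (2 + k) (2 + (k + k))) (suc i)
    ≡⟨ ballotSum-step (suc k) (suc (k + k)) i (≤-reflexive 2k≡) ⟩
  coeff (ballotSum (2 + k) (suc (k + k))) i ℚ.- coeff (ballotSum (suc k) (suc (k + k))) (2 + i)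
    ≡⟨ cong (ℚ._- coeff (ballotSum (suc k) (suc (k + k))) (2 + i)) drop-last ⟩
  coeff (ballotSum (suc k) (suc (k + k))) i ℚ.- coeff (ballotSum (suc k) (suc (k + k))) (2 + i) ∎
  where
  2k≡ : 2 * suc k ≡ 2 + (k + k)
  2k≡ = trans (2*suc k) (cong (λ m → 2 + (k + m)) (+-identityʳ k))
  drop-last : coeff (ballotSum (2 + k) (suc (k + k))) i ≡ coeff (ballotSum (suc k) (suc (k + k))) i
  drop-last rewrite coeff-ballotSum-last (suc k) (suc (k + k)) i
               | signedBallot-middle k
    = trans (cong (coeff (ballotSum (suc k) (suc (k + k))) i ℚ.+_)
                  (ℚ.*-zeroˡ (coeff (x ^ (2 + (k + k) ∸ 2 * suc k)) i)))
            (ℚ.+-identityʳ _)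

-- The recurrences for B and b

-- Symmetry of the binomials: (n + k) - (n - k) = 2k. The new form vanishes for k > n, since then n
-- + k < 2k.
coeff-b : ∀ n i → coeff (b n) i ≡ fromℕ ((n + i) C (i + i))
coeff-b n = coeff-∑-x^ (suc n) (λ k → fromℕ ((n + k) C (n ∸ k))) (λ k → fromℕ ((n + k) C (k + k)))
  (λ { {k} (s≤s k≤n) → cong fromℕ (C-sym k k≤n) })
  (λ { {k} n<k → cong fromℕ (k>n⇒nCk≡0 (+-monoˡ-< k n<k)) })
  where
  [m+n]∸[o+n]≡m∸o : ∀ m n o → (m + n) ∸ (o + n) ≡ m ∸ o
  [m+n]∸[o+n]≡m∸o m n o rewrite +-comm m n | +-comm o n = [m+n]∸[m+o]≡n∸o n m o
  C-sym : ∀ k → k ≤ n → (n + k) C (n ∸ k) ≡ (n + k) C (k + k)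
  C-sym k k≤n = sym (trans (nCk≡nC[n∸k] (+-monoˡ-≤ k k≤n))
    (cong ((n + k) C_) ([m+n]∸[o+n]≡m∸o n k k)))

coeff-B-zero : ∀ n → coeff (B n) 0 ≡ 0ℚ
coeff-B-zero n = coeff-∑-x^suc-zero n (λ k → fromℕ (((n ∸ 1) + suc k) C (n ∸ suc k))) (λ k → k)

-- Symmetry again, now with n + k - (n - k - 1) = 2k + 1. The truncation in `n ∸ 1` does no harm, as
-- n = 0 leaves no k < n.
coeff-B-suc : ∀ n i → coeff (B n) (suc i) ≡ fromℕ ((n + i) C suc (i + i))
coeff-B-suc n i = trans (coeff-∑-x^suc-suc n (λ k → fromℕ (((n ∸ 1) + suc k) C (n ∸ suc k))) (λ k → k) i)
  (coeff-∑-x^ n (λ k → fromℕ (((n ∸ 1) + suc k) C (n ∸ suc k))) (λ k → fromℕ ((n + k) C suc (k + k)))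
    (cong fromℕ ∘ C-sym n)
    (λ {k} n≤k → cong fromℕ (k>n⇒nCk≡0 (s≤s (+-monoˡ-≤ k n≤k)))) i)
  where
  C-sym : ∀ n {k} → k < n → ((n ∸ 1) + suc k) C (n ∸ suc k) ≡ (n + k) C suc (k + k)
  C-sym (suc m) {k} (s≤s k≤m) rewrite +-suc m k =
    sym (trans (nCk≡nC[n∸k] (s≤s (+-monoˡ-≤ k k≤m)))
    (cong (suc (m + k) C_)
      (trans (cong (_∸ (k + k)) (+-comm m k)) ([m+n]∸[m+o]≡n∸o k m k))))

-- Pascal's rule in row n + i: `b` supplies column 2i and `B` column 2i + 1.
B-suc : ∀ n → B (suc n) ≈ (0ℚ ∷ b n) +ₚ B n
B-suc n = mk≈ λ i → trans (at i) (sym (coeff-+ (0ℚ ∷ b n) (B n) i))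
  where
  at : ∀ i → coeff (B (suc n)) i ≡ coeff (0ℚ ∷ b n) i ℚ.+ coeff (B n) i
  at zero    = begin
    coeff (B (suc n)) 0      ≡⟨ coeff-B-zero (suc n) ⟩
    0ℚ ℚ.+ 0ℚ                ≡⟨ cong (0ℚ ℚ.+_) (coeff-B-zero n) ⟨
    0ℚ ℚ.+ coeff (B n) 0     ∎
  at (suc i) = begin
    coeff (B (suc n)) (suc i)
      ≡⟨ coeff-B-suc (suc n) i ⟩
    fromℕ (suc (n + i) C suc (i + i))
      ≡⟨ cong fromℕ (nCk+nC[k+1]≡[n+1]C[k+1] (n + i) (i + i)) ⟨
    fromℕ ((n + i) C (i + i) + (n + i) C suc (i + i))
      ≡⟨ fromℕ-+ ((n + i) C (i + i)) ((n + i) C suc (i + i)) ⟩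
    fromℕ ((n + i) C (i + i)) ℚ.+ fromℕ ((n + i) C suc (i + i))
      ≡⟨ cong₂ ℚ._+_ (coeff-b n i) (coeff-B-suc n i) ⟨
    coeff (b n) i ℚ.+ coeff (B n) (suc i) ∎

-- Pascal's rule in row n + i + 1, columns 2i + 1 and 2i + 2. Both constant coefficients of `b` are
-- 1.
b-suc : ∀ n → b (suc n) ≈ B (suc n) +ₚ b n
b-suc n = mk≈ λ i → trans (at i) (sym (coeff-+ (B (suc n)) (b n) i))
  where
  at : ∀ i → coeff (b (suc n)) i ≡ coeff (B (suc n)) i ℚ.+ coeff (b n) i
  at zero    = begin
    coeff (b (suc n)) 0                       ≡⟨ coeff-b (suc n) 0 ⟩
    1ℚ                                        ≡⟨ coeff-b n 0 ⟨
    coeff (b n) 0                             ≡⟨ ℚ.+-identityˡ (coeff (b n) 0) ⟨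
    0ℚ ℚ.+ coeff (b n) 0                      ≡⟨ cong (ℚ._+ coeff (b n) 0) (coeff-B-zero (suc n)) ⟨
    coeff (B (suc n)) 0 ℚ.+ coeff (b n) 0     ∎
  at (suc i) = begin
    coeff (b (suc n)) (suc i)
      ≡⟨ coeff-b (suc n) (suc i) ⟩
    fromℕ ((suc n + suc i) C (suc i + suc i))
      ≡⟨ cong fromℕ (nCk+nC[k+1]≡[n+1]C[k+1] (n + suc i) (i + suc i)) ⟨
    fromℕ ((n + suc i) C (i + suc i) + (n + suc i) C (suc i + suc i))
      ≡⟨ fromℕ-+ ((n + suc i) C (i + suc i)) ((n + suc i) C (suc i + suc i)) ⟩
    fromℕ ((n + suc i) C (i + suc i)) ℚ.+ fromℕ ((n + suc i) C (suc i + suc i))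
      ≡⟨ cong₂ (λ m k → fromℕ (m C k) ℚ.+ fromℕ ((n + suc i) C (suc i + suc i))) (+-suc n i) (+-suc i i) ⟩
    fromℕ ((suc n + i) C suc (i + i)) ℚ.+ fromℕ ((n + suc i) C (suc i + suc i))
      ≡⟨ cong₂ ℚ._+_ (coeff-B-suc (suc n) i) (coeff-b n (suc i)) ⟨
    coeff (B (suc n)) (suc i) ℚ.+ coeff (b n) (suc i) ∎

-- Substitution of x²

-- Turns the coefficient sequence of p(x) into that of p(x²). On sequences, unlike lists, trailing
-- zeros cause no distinction, so substitution respects `_≈_`.
spread : (ℕ → ℚ) → ℕ → ℚ
spread f zero          = f 0
spread f (suc zero)    = 0ℚ
spread f (suc (suc i)) = spread (f ∘ suc) i

spread-cong : ∀ {f g} → (∀ i → f i ≡ g i) → ∀ i → spread f i ≡ spread g i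
spread-cong f≡g zero          = f≡g 0
spread-cong f≡g (suc zero)    = refl
spread-cong f≡g (suc (suc i)) = spread-cong (f≡g ∘ suc) i

spread-+ : ∀ f g i → spread (λ k → f k ℚ.+ g k) i ≡ spread f i ℚ.+ spread g i
spread-+ f g zero          = refl
spread-+ f g (suc zero)    = refl
spread-+ f g (suc (suc i)) = spread-+ (f ∘ suc) (g ∘ suc) i

spread-0 : ∀ i → spread (λ _ → 0ℚ) i ≡ 0ℚ
spread-0 zero          = refl
spread-0 (suc zero)    = refl
spread-0 (suc (suc i)) = spread-0 i

x²*ₚ≈shift : ∀ p → x ^ 2 *ₚ p ≈ 0ℚ ∷ 0ℚ ∷ p
x²*ₚ≈shift p = mk≈ λ i → trans (coeff-+ (0ℚ · p) (0ℚ ∷ x *ₚ p) i)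
  (trans (cong (ℚ._+ coeff (0ℚ ∷ x *ₚ p) i) (trans (coeff-· 0ℚ p i) (ℚ.*-zeroˡ (coeff p i))))
  (trans (ℚ.+-identityˡ _) (at i)))
  where
  at : ∀ i → coeff (0ℚ ∷ x *ₚ p) i ≡ coeff (0ℚ ∷ 0ℚ ∷ p) i
  at zero    = refl
  at (suc i) = coeff-≡ (x*ₚ≈shift p) i

coeff-⟨x²⟩ : ∀ p i → coeff (p ⟨ x ^ 2 ⟩) i ≡ spread (coeff p) i
coeff-⟨x²⟩ []      i = sym (spread-0 i)
coeff-⟨x²⟩ (a ∷ p) i = trans (coeff-+ (const a) (x ^ 2 *ₚ p ⟨ x ^ 2 ⟩) i)
  (trans (cong (coeff (const a) i ℚ.+_) (coeff-≡ (x²*ₚ≈shift (p ⟨ x ^ 2 ⟩)) i)) (at i))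
  where
  at : ∀ i → coeff (const a) i ℚ.+ coeff (0ℚ ∷ 0ℚ ∷ p ⟨ x ^ 2 ⟩) i ≡ spread (coeff (a ∷ p)) i
  at zero          = ℚ.+-identityʳ a
  at (suc zero)    = refl
  at (suc (suc i)) = trans (ℚ.+-identityˡ _) (coeff-⟨x²⟩ p i)

⟨x²⟩-+ : ∀ p q r → p ≈ q +ₚ r → ∀ i →
  coeff (p ⟨ x ^ 2 ⟩) i ≡ coeff (q ⟨ x ^ 2 ⟩) i ℚ.+ coeff (r ⟨ x ^ 2 ⟩) i
⟨x²⟩-+ p q r p≈q+r i = begin
  coeff (p ⟨ x ^ 2 ⟩) i
    ≡⟨ coeff-⟨x²⟩ p i ⟩
  spread (coeff p) i
    ≡⟨ spread-cong (λ k → trans (coeff-≡ p≈q+r k) (coeff-+ q r k)) i ⟩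
  spread (λ k → coeff q k ℚ.+ coeff r k) i
    ≡⟨ spread-+ (coeff q) (coeff r) i ⟩
  spread (coeff q) i ℚ.+ spread (coeff r) i
    ≡⟨ cong₂ ℚ._+_ (coeff-⟨x²⟩ q i) (coeff-⟨x²⟩ r i) ⟨
  coeff (q ⟨ x ^ 2 ⟩) i ℚ.+ coeff (r ⟨ x ^ 2 ⟩) i ∎

-- Fibonacci polynomials

fib : ℕ → ℚ[x]
fib zero          = []
fib (suc zero)    = const 1ℚ
fib (suc (suc k)) = (0ℚ ∷ fib (suc k)) +ₚ fib k

-- Writing the factor x as a leading zero makes `u k` equal to `shift 1 (fib k)` by computation,
-- visibly without constant term.
u : ℕ → ℚ[x]
u k = 0ℚ ∷ fib k

0∷b⟨x²⟩≈u : ∀ n → x *ₚ b n ⟨ x ^ 2 ⟩ ≈ u (suc (2 * n)) →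
  ∀ i → coeff (0ℚ ∷ b n ⟨ x ^ 2 ⟩) i ≡ coeff (u (suc (2 * n))) i
0∷b⟨x²⟩≈u n xb≈u i = trans (sym (coeff-≡ (x*ₚ≈shift (b n ⟨ x ^ 2 ⟩)) i)) (coeff-≡ xb≈u i)

-- By `B-suc`, the left side is x² bₙ(x²) + Bₙ(x²), that is x u₂ₙ₊₁ + u₂ₙ.
B⟨x²⟩-suc : ∀ n → B n ⟨ x ^ 2 ⟩ ≈ u (2 * n) → x *ₚ b n ⟨ x ^ 2 ⟩ ≈ u (suc (2 * n)) →
  B (suc n) ⟨ x ^ 2 ⟩ ≈ u (2 * suc n)
B⟨x²⟩-suc n B≈u xb≈u = mk≈ λ i → begin
  coeff (B (suc n) ⟨ x ^ 2 ⟩) i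
    ≡⟨ ⟨x²⟩-+ (B (suc n)) (0ℚ ∷ b n) (B n) (B-suc n) i ⟩
  coeff ((0ℚ ∷ b n) ⟨ x ^ 2 ⟩) i ℚ.+ coeff (B n ⟨ x ^ 2 ⟩) i
    ≡⟨ cong₂ ℚ._+_ (trans (coeff-⟨x²⟩ (0ℚ ∷ b n) i) (at i)) (coeff-≡ B≈u i) ⟩
  coeff (0ℚ ∷ u (suc (2 * n))) i ℚ.+ coeff (u (2 * n)) i
    ≡⟨ coeff-+ (0ℚ ∷ u (suc (2 * n))) (u (2 * n)) i ⟨
  coeff (u (2 + 2 * n)) i
    ≡⟨ cong (λ m → coeff (u m) i) (2*suc n) ⟨
  coeff (u (2 * suc n)) i ∎
  where
  at : ∀ i → spread (coeff (0ℚ ∷ b n)) i ≡ coeff (0ℚ ∷ u (suc (2 * n))) i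
  at zero          = refl
  at (suc zero)    = refl
  at (suc (suc i)) = trans (sym (coeff-⟨x²⟩ (b n) i)) (0∷b⟨x²⟩≈u n xb≈u (suc i))

-- By `b-suc`, the left side is x Bₙ₊₁(x²) + x bₙ(x²), that is x u₂ₙ₊₂ + u₂ₙ₊₁.
x*b⟨x²⟩-suc : ∀ n → B (suc n) ⟨ x ^ 2 ⟩ ≈ u (2 * suc n) → x *ₚ b n ⟨ x ^ 2 ⟩ ≈ u (suc (2 * n)) →
  x *ₚ b (suc n) ⟨ x ^ 2 ⟩ ≈ u (suc (2 * suc n))
x*b⟨x²⟩-suc n B≈u xb≈u = mk≈ λ i → begin
  coeff (x *ₚ b (suc n) ⟨ x ^ 2 ⟩) i
    ≡⟨ coeff-≡ (x*ₚ≈shift (b (suc n) ⟨ x ^ 2 ⟩)) i ⟩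
  coeff (0ℚ ∷ b (suc n) ⟨ x ^ 2 ⟩) i
    ≡⟨ at i ⟩
  coeff (0ℚ ∷ u (2 * suc n)) i ℚ.+ coeff (0ℚ ∷ b n ⟨ x ^ 2 ⟩) i
    ≡⟨ cong₂ (λ m a → coeff (0ℚ ∷ u m) i ℚ.+ a) (2*suc n) (0∷b⟨x²⟩≈u n xb≈u i) ⟩
  coeff (0ℚ ∷ u (2 + 2 * n)) i ℚ.+ coeff (u (suc (2 * n))) i
    ≡⟨ coeff-+ (0ℚ ∷ u (2 + 2 * n)) (u (suc (2 * n))) i ⟨
  coeff (u (3 + 2 * n)) i
    ≡⟨ cong (λ m → coeff (u (suc m)) i) (2*suc n) ⟨
  coeff (u (suc (2 * suc n))) i ∎
  where
  at : ∀ i → coeff (0ℚ ∷ b (suc n) ⟨ x ^ 2 ⟩) i ≡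
    coeff (0ℚ ∷ u (2 * suc n)) i ℚ.+ coeff (0ℚ ∷ b n ⟨ x ^ 2 ⟩) i
  at zero    = refl
  at (suc i) = trans (⟨x²⟩-+ (b (suc n)) (B (suc n)) (b n) (b-suc n) i)
    (cong (ℚ._+ coeff (b n ⟨ x ^ 2 ⟩) i) (coeff-≡ B≈u i))

B,x*b⟨x²⟩≈u : ∀ n → (B n ⟨ x ^ 2 ⟩ ≈ u (2 * n)) × (x *ₚ b n ⟨ x ^ 2 ⟩ ≈ u (suc (2 * n)))
B,x*b⟨x²⟩≈u zero =
  -- `B 0` is the empty sum and `u 0` is zero, so the induction can start at n = 0.
  mk≈ (λ { zero → refl ; (suc i) → refl }) ,
  mk≈ (λ { 0 → refl ; 1 → refl ; 2 → refl ; 3 → refl ; (suc (suc (suc (suc i)))) → refl })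
B,x*b⟨x²⟩≈u (suc n) =
  let B≈u , xb≈u = B,x*b⟨x²⟩≈u n
      B≈u′       = B⟨x²⟩-suc n B≈u xb≈u
  in B≈u′ , x*b⟨x²⟩-suc n B≈u′ xb≈u

-- The transformation

-- Multiplication by xᵏ. The offset `k` is the degree reached as coefficients are peeled off one by
-- one, which allows `T` to be evaluated by induction on the list.
shift : ℕ → ℚ[x] → ℚ[x]
shift k p = replicate k 0ℚ ++ p

shift-∷ : ∀ k a p i → coeff (shift k (a ∷ p)) i ≡ coeff (a · x ^ k +ₚ shift (suc k) p) i
shift-∷ k a p i = sym (trans (coeff-+ (a · x ^ k) (shift (suc k) p) i)
  (trans (cong (ℚ._+ coeff (shift (suc k) p) i) (coeff-· a (x ^ k) i)) (at k i)))
  where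
  at : ∀ k i → a ℚ.* coeff (x ^ k) i ℚ.+ coeff (shift (suc k) p) i ≡ coeff (shift k (a ∷ p)) i
  at zero    zero    = trans (ℚ.+-identityʳ _) (ℚ.*-identityʳ a)
  at zero    (suc i) = trans (cong (ℚ._+ coeff p i) (ℚ.*-zeroʳ a)) (ℚ.+-identityˡ _)
  at (suc k) zero    rewrite coeff-x^-zero k | ℚ.*-zeroʳ a = refl
  at (suc k) (suc i) rewrite coeff-x^-suc k i = at k i

shift-[] : ∀ k i → coeff (shift k []) i ≡ 0ℚ
shift-[] zero    i       = refl
shift-[] (suc k) zero    = refl
shift-[] (suc k) (suc i) = shift-[] k i

module _ (T : ℚ[x] → ℚ[x]) (T-linear : IsLinear T) (T-x^ : ∀ n → T (x ^ n) ≈ Q̃ n) where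

  coeff-T-+ : ∀ p q i → coeff (T (p +ₚ q)) i ≡ coeff (T p) i ℚ.+ coeff (T q) i
  coeff-T-+ p q i = trans (coeff-≡ (+ᴹ-homo T-linear p q) i) (coeff-+ (T p) (T q) i)

  coeff-T-shift-[] : ∀ k i → coeff (T (shift k [])) i ≡ 0ℚ
  coeff-T-shift-[] k i =
    trans (coeff-≡ (⟦⟧-cong T-linear (mk≈ (shift-[] k))) i) (coeff-≡ (0ᴹ-homo T-linear) i)

  coeff-T-shift-∷ : ∀ k a p i → coeff (T (shift k (a ∷ p))) i ≡
    a ℚ.* coeff (Q̃ k) i ℚ.+ coeff (T (shift (suc k) p)) i
  coeff-T-shift-∷ k a p i = begin
    coeff (T (shift k (a ∷ p))) i
      ≡⟨ coeff-≡ (⟦⟧-cong T-linear (mk≈ (shift-∷ k a p))) i ⟩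
    coeff (T (a · x ^ k +ₚ shift (suc k) p)) i
      ≡⟨ coeff-T-+ (a · x ^ k) (shift (suc k) p) i ⟩
    coeff (T (a · x ^ k)) i ℚ.+ coeff (T (shift (suc k) p)) i
      ≡⟨ cong (ℚ._+ coeff (T (shift (suc k) p)) i) (begin
           coeff (T (a · x ^ k)) i  ≡⟨ coeff-≡ (*ₗ-homo T-linear a (x ^ k)) i ⟩
           coeff (a · T (x ^ k)) i  ≡⟨ coeff-· a (T (x ^ k)) i ⟩
           a ℚ.* coeff (T (x ^ k)) i ≡⟨ cong (a ℚ.*_) (coeff-≡ (T-x^ k) i) ⟩
           a ℚ.* coeff (Q̃ k) i ∎) ⟩
    a ℚ.* coeff (Q̃ k) i ℚ.+ coeff (T (shift (suc k) p)) i ∎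

  T-shift-zero : ∀ p k → coeff (T (shift (suc k) p)) 0 ≡ 0ℚ
  T-shift-zero []      k = coeff-T-shift-[] (suc k) 0
  T-shift-zero (a ∷ p) k
    rewrite coeff-T-shift-∷ (suc k) a p 0 | Q̃-zero k | T-shift-zero p (suc k) | ℚ.*-zeroʳ a = refl

  -- This is T (x p) = M (T p) above the constant coefficient: `Q̃-suc` extended by linearity. The
  -- offset `k` is arbitrary because each peeled coefficient raises it.
  T-shift-suc : ∀ p k i → coeff (T (shift (2 + k) p)) (suc i) ≡
    coeff (T (shift (1 + k) p)) i ℚ.- coeff (T (shift (1 + k) p)) (2 + i)
  T-shift-suc [] k i
    rewrite coeff-T-shift-[] (2 + k) (suc i) | coeff-T-shift-[] (1 + k) i
          | coeff-T-shift-[] (1 + k) (2 + i) = refl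
  T-shift-suc (a ∷ p) k i = begin
    coeff (T (shift (2 + k) (a ∷ p))) (suc i)
      ≡⟨ coeff-T-shift-∷ (2 + k) a p (suc i) ⟩
    a ℚ.* coeff (Q̃ (2 + k)) (suc i) ℚ.+ coeff (T (shift (3 + k) p)) (suc i)
      ≡⟨ cong₂ (λ y z → a ℚ.* y ℚ.+ z) (Q̃-suc k i) (T-shift-suc p (suc k) i) ⟩
    a ℚ.* (q ℚ.- r) ℚ.+ (s ℚ.- t)
      ≡⟨ solveℚ 5 (λ a q r s t → a ⊗ (q ⊖ r) ⊕ (s ⊖ t) ⊜ (a ⊗ q ⊕ s) ⊖ (a ⊗ r ⊕ t)) refl a q r s t ⟩
    (a ℚ.* q ℚ.+ s) ℚ.- (a ℚ.* r ℚ.+ t)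
      ≡⟨ cong₂ ℚ._-_ (coeff-T-shift-∷ (1 + k) a p i) (coeff-T-shift-∷ (1 + k) a p (2 + i)) ⟨
    coeff (T (shift (1 + k) (a ∷ p))) i ℚ.- coeff (T (shift (1 + k) (a ∷ p))) (2 + i) ∎
    where
    q = coeff (Q̃ (1 + k)) i
    r = coeff (Q̃ (1 + k)) (2 + i)
    s = coeff (T (shift (2 + k) p)) i
    t = coeff (T (shift (2 + k) p)) (2 + i)

  -- The hypothesis on u k is the part of T (u k) ≈ x ^ k above the constant
  -- coefficient, so that k = 0, where T (u 0) is 0 and not x ^ 0, is included.
  T-u-suc : ∀ k → T (u (suc k)) ≈ x ^ suc k →
    (∀ i → coeff (T (u k)) (suc i) ≡ coeff (x ^ suc k) (2 + i)) → T (u (2 + k)) ≈ x ^ (2 + k)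
  T-u-suc k T-u₁ T-u₀ = mk≈ at
    where
    at : ∀ i → coeff (T (u (2 + k))) i ≡ coeff (x ^ (2 + k)) i
    -- The constant coefficient, where M may drop a term, is treated separately.
    at zero    = trans (T-shift-zero (fib (2 + k)) 0) (sym (coeff-x^-zero (suc k)))
    at (suc i) = begin
      coeff (T (u (2 + k))) (suc i)
        ≡⟨ coeff-T-+ (shift 2 (fib (suc k))) (u k) (suc i) ⟩
      coeff (T (shift 2 (fib (suc k)))) (suc i) ℚ.+ coeff (T (u k)) (suc i)
        ≡⟨ cong₂ ℚ._+_ (T-shift-suc (fib (suc k)) 0 i) (T-u₀ i) ⟩
      coeff (T (u (suc k))) i ℚ.- coeff (T (u (suc k))) (2 + i) ℚ.+ r
        ≡⟨ cong₂ (λ a b → a ℚ.- b ℚ.+ r) (coeff-≡ T-u₁ i) (coeff-≡ T-u₁ (2 + i)) ⟩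
      coeff (x ^ suc k) i ℚ.- r ℚ.+ r
        -- The subtracted `r` comes from the term -xᵏ of M xᵏ⁺¹, and `T (u k)` restores it.
        ≡⟨ solveℚ 2 (λ a b → (a ⊖ b) ⊕ b ⊜ a) refl (coeff (x ^ suc k) i) r ⟩
      coeff (x ^ suc k) i
        ≡⟨ coeff-x^-suc (suc k) i ⟨
      coeff (x ^ (2 + k)) (suc i) ∎
      where
      r = coeff (x ^ suc k) (2 + i)

  T-u : ∀ k → T (u (suc k)) ≈ x ^ suc k
  -- `u 1` and `x ^ 1` compute to the same list.
  T-u zero = mk≈ λ i → trans (coeff-≡ (T-x^ 1) i) (at i)
    where
    at : ∀ i → coeff (Q̃ 1) i ≡ coeff (x ^ 1) i
    at 0             = refl
    at 1             = refl
    at (suc (suc i)) = refl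
  -- `u 0` is `shift 1 []`, so its image is 0, in agreement with x having no coefficient in degree 2
  -- or higher.
  T-u (suc zero) = T-u-suc 0 (T-u 0) (coeff-T-shift-[] 1 ∘ suc)
  T-u (suc (suc k)) = T-u-suc (suc k) (T-u (suc k))
    (λ i → trans (coeff-≡ (T-u k) (suc i)) (sym (coeff-x^-suc (suc k) (suc i))))

corollary5p2 : (T : ℚ[x] → ℚ[x]) →
    IsLinear T →
    (∀ n → T (x ^ n) ≈ Q̃ n) →
    (∀ n → n ≥ 1 → T (B n ⟨ x ^ 2 ⟩) ≈ x ^ (2 * n)) ×
    (∀ n → T (x *ₚ b n ⟨ x ^ 2 ⟩) ≈ x ^ (2 * n + 1))
corollary5p2 T T-linear T-x^ = even-case , odd-case
  where
  even-case : ∀ n → n ≥ 1 → T (B n ⟨ x ^ 2 ⟩) ≈ x ^ (2 * n)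
  even-case (suc n) _ = mk≈ λ i →
    -- `2 * suc n` computes to the successor of `n + suc (n + 0)`.
    trans (coeff-≡ (⟦⟧-cong T-linear (proj₁ (B,x*b⟨x²⟩≈u (suc n)))) i) (coeff-≡ (T-u T T-linear T-x^ (n + suc (n + 0))) i)
  odd-case : ∀ n → T (x *ₚ b n ⟨ x ^ 2 ⟩) ≈ x ^ (2 * n + 1)
  odd-case n = mk≈ λ i → begin
    coeff (T (x *ₚ b n ⟨ x ^ 2 ⟩)) i ≡⟨ coeff-≡ (⟦⟧-cong T-linear (proj₂ (B,x*b⟨x²⟩≈u n))) i ⟩
    coeff (T (u (suc (2 * n)))) i    ≡⟨ coeff-≡ (T-u T T-linear T-x^ (2 * n)) i ⟩
    coeff (x ^ suc (2 * n)) i        ≡⟨ cong (λ m → coeff (x ^ m) i) (+-comm 1 (2 * n)) ⟩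
    coeff (x ^ (2 * n + 1)) i        ∎
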